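{- Let $\phi$ be a Paraconsistent Non-dependence Logic sentence that is consistent. Then $\phi$ is logically equivalent to its flattening $\phi^f$, that is, for all models $M$ over the signature of $\phi$ and all $d\in\{+,-\}$, $M\models_P^d\phi$ if and only if $M\models_P^d\phi^f$.
   Context: A sentence $\phi$ is consistent if there is no model $M$ such that both $M\models_P^+\phi$ and $M\models_P^-\phi$. The flattening $\psi^f$ of a formula $\psi$ is the first-order formula defined recursively by: $\psi^f=\psi$ for first-order atoms; $({=}(\vec t_1,\vec t_2))^f=\top$; $(\lnot\psi)^f=\lnot(\psi^f)$; $(\psi\vee\theta)^f=\psi^f\vee\theta^f$; $(\exists v\psi)^f=\exists v(\psi^f)$. Here $\top$ is an always-true first-order sentence. Syntax. Over a first-order signature $\Sigma$, the formulas of Paraconsistent Non-dependence Logic are $\psi ::= R\vec t \mid t_1=t_2 \mid {=}(\vec t_1,\vec t_2) \mid \lnot\psi \mid \psi\vee\psi \mid \exists v\,\psi$, where $\vec t,\vec t_1,\vec t_2$ are (possibly empty) tuples of $\Sigma$-terms; ${=}(\vec t_1,\vec t_2)$ is called a dependence atom. $\psi\wedge\theta$ abbreviates $\lnot(\lnot\psi\vee\lnot\theta)$ and $\forall v\,\psi$ abbreviates $\lnot\exists v\lnot\psi$. Free variables are defined as usual (all variables in an atom, including dependence atoms, are free); a sentence is a formula with no free variables. Teams. Models have nonempty domain. A team over $M$ with domain $V$ is a set $X$ of assignments $s:V\to\mathrm{Dom}(M)$. $\vec t\langle s\rangle$ denotes the value of the tuple $\vec t$ under $s$. Games. Let $\mathrm{Free}(\psi)\subseteq\mathrm{Dom}(X)$.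 The game $G^M_X(\psi)$ is played by Eloise and Abelard; $\alpha^*$ denotes the opponent of $\alpha$. Positions are triples $(\chi,s,\alpha)$ with $\chi$ an occurrence of a subformula of $\psi$, $s$ an assignment and $\alpha$ a player; the possible starting positions are $(\psi,s,\text{Eloise})$ for $s\in X$. Rules: at $(R\vec t,s,\alpha)$ or $(t_1=t_2,s,\alpha)$, $\alpha$ wins if the atom is true in $M$ under $s$, otherwise $\alpha^*$ wins; at $({=}(\vec t_1,\vec t_2),s,\alpha)$, $\alpha$ wins; from $(\lnot\chi,s,\alpha)$ the game moves to $(\chi,s,\alpha^*)$; from $(\chi\vee\theta,s,\alpha)$, $\alpha$ chooses $(\chi,s,\alpha)$ or $(\theta,s,\alpha)$; from $(\exists v\chi,s,\alpha)$, $\alpha$ chooses $m\in\mathrm{Dom}(M)$ and the game moves to $(\chi,s[m/v],\alpha)$. A (possibly nondeterministic) strategy for a player selects a nonempty set of allowed successors at each position where that player chooses; it is winning if every play from any starting position in which the player's choices conform to it is won by that player. A strategy for $\alpha$ is uniform if for any two plays conforming to it and ending in $({=}(\vec t_1,\vec t_2),s,\alpha)$ and $({=}(\vec t_1,\vec t_2),s',\alpha)$ for the same occurrence of the dependence atom, $\vec t_1\langle s\rangle=\vec t_1\langle s'\rangle$ implies $\vec t_2\langle s\rangle=\vec t_2\langle s'\rangle$. Paraconsistent satisfaction. $(M,X)\models_P^+\psi$ iff Abelard has no uniform winning strategy in $G^M_X(\psi)$; $(M,X)\models_P^-\psi$ iff Eloise has no uniform winning strategy in $G^M_X(\psi)$.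 For a sentence $\phi$, $M\models_P^{\pm}\phi$ means $(M,\{\emptyset\})\models_P^{\pm}\phi$, where $\{\emptyset\}$ is the team containing only the empty assignment. -}

module Defs where


open import Data.List.Base using (List; []; _∷_)
open import Data.List.Membership.Propositional using (_∈_)
open import Data.List.Relation.Unary.Any using (here; tail)
open import Data.Nat.Base using (ℕ)
open import Data.Nat.Properties using (_≟_)
open import Data.Product.Base using (_×_; ∃-syntax)
open import Data.Vec.Base using (Vec; []; _∷_)
open import Level using (0ℓ)
open import Relation.Binary.PropositionalEquality using (_≡_; refl)
open import Relation.Nullary using (¬_; yes; no)
open import Relation.Unary using (Pred; Satisfiable) renaming (_∈_ to _∈ₚ_)

record Signature : Set₁ where
  field
    Fun    : Set
    Rel    : Set
    funAr  : Fun → ℕ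
    relAr  : Rel → ℕ

Var : Set
Var = ℕ

-- Variables are named (not de Bruijn), so that requantifying a variable
-- overwrites its value.  `Term Σ V` and `Formula Σ V` consist of the terms and
-- formulas all of whose free variables lie in the finite set V; a repeated
-- entry of V has no effect, since membership proofs are irrelevant.

data Term (Σ : Signature) (V : List Var) : Set where
  var : (v : Var) → .(v ∈ V) → Term Σ V
  fun : (f : Signature.Fun Σ) → Vec (Term Σ V) (Signature.funAr Σ f) → Term Σ V

infix  25 _≐_
infixr 20 _∨_
infix  22 ∼_

data Formula (Σ : Signature) (V : List Var) : Set where
  rel  : (R : Signature.Rel Σ) → Vec (Term Σ V) (Signature.relAr Σ R) → Formula Σ V
  _≐_  : Term Σ V → Term Σ V → Formula Σ V
  dep  : {m n : ℕ} → Vec (Term Σ V) m → Vec (Term Σ V) n → Formula Σ V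
  ∼_   : Formula Σ V → Formula Σ V
  _∨_  : Formula Σ V → Formula Σ V → Formula Σ V
  ex   : (v : Var) → Formula Σ (v ∷ V) → Formula Σ V

Sentence : Signature → Set
Sentence Σ = Formula Σ []

all : {Σ : Signature} {V : List Var} (v : Var) → Formula Σ (v ∷ V) → Formula Σ V
all v χ = ∼ ex v (∼ χ)

-- The language has no primitive always-true sentence, so we take ∀x (x = x).
truth : {Σ : Signature} {V : List Var} → Formula Σ V
truth = all 0 (var 0 (here refl) ≐ var 0 (here refl))

flatten : {Σ : Signature} {V : List Var} → Formula Σ V → Formula Σ V
flatten (rel R ts)  = rel R ts
flatten (t ≐ u)     = t ≐ u
flatten (dep ts us) = truth
flatten (∼ χ)       = ∼ flatten χ
flatten (χ ∨ θ)     = flatten χ ∨ flatten θ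
flatten (ex v χ)    = ex v (flatten χ)

record Model (Σ : Signature) : Set₁ where
  open Signature Σ
  field
    Dom      : Set
    nonempty : Dom
    ⟦_⟧ᶠ     : (f : Fun) → Vec Dom (funAr f) → Dom
    ⟦_⟧ʳ     : (R : Rel) → Pred (Vec Dom (relAr R)) 0ℓ

data Player : Set where
  Eloise Abelard : Player

_* : Player → Player
Eloise  * = Abelard
Abelard * = Eloise

data Side : Set where
  left right : Side

data Sign : Set where
  pos neg : Sign

-- Occ ψ χ is the type of occurrences of χ as a subformula of ψ.
data Occ {Σ : Signature} {V : List Var} (ψ : Formula Σ V) :
         {W : List Var} → Formula Σ W → Set where
  root : Occ ψ ψ
  ∼↓   : {W : List Var} {χ : Formula Σ W} → Occ ψ (∼ χ) → Occ ψ χ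
  ∨↓ˡ  : {W : List Var} {χ θ : Formula Σ W} → Occ ψ (χ ∨ θ) → Occ ψ χ
  ∨↓ʳ  : {W : List Var} {χ θ : Formula Σ W} → Occ ψ (χ ∨ θ) → Occ ψ θ
  ex↓  : {W : List Var} {v : Var} {χ : Formula Σ (v ∷ W)} → Occ ψ (ex v χ) → Occ ψ χ

module _ {Σ : Signature} (M : Model Σ) where
  open Signature Σ
  open Model M

  Assignment : List Var → Set
  Assignment V = (v : Var) → .(v ∈ V) → Dom

  ∅ : Assignment []
  ∅ v ()

  -- Equality of assignments as functions V → Dom.
  _≈_ : {V : List Var} → Assignment V → Assignment V → Set
  _≈_ {V} s s′ = (v : Var) .(v∈V : v ∈ V) → s v v∈V ≡ s′ v v∈V

  _[_/_] : {V : List Var} → Assignment V → Dom → (v : Var) → Assignment (v ∷ V)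
  (s [ m / v ]) w w∈ with w ≟ v
  ... | yes _   = m
  ... | no  w≢v = s w (tail w≢v w∈)

  val  : {V : List Var} → Term Σ V → Assignment V → Dom
  vals : {V : List Var} {n : ℕ} → Vec (Term Σ V) n → Assignment V → Vec Dom n
  val (var v v∈V) s = s v v∈V
  val (fun f ts)  s = ⟦ f ⟧ᶠ (vals ts s)
  vals []       s = []
  vals (t ∷ ts) s = val t s ∷ vals ts s

  Team : List Var → Set₁
  Team V = Pred (Assignment V) 0ℓ

  -- The team {∅}.
  ｛∅｝ : Team []
  ｛∅｝ s = s ≈ ∅

  -- WonBy s α χ β: the position (χ, s, α), with χ atomic, is won by β.
  data WonBy {W : List Var} (s : Assignment W) (α : Player) :
             Formula Σ W → Player → Set where
    rel-true  : {R : Rel} {ts : Vec (Term Σ W) (relAr R)} →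
                ⟦ R ⟧ʳ (vals ts s) → WonBy s α (rel R ts) α
    rel-false : {R : Rel} {ts : Vec (Term Σ W) (relAr R)} →
                ¬ ⟦ R ⟧ʳ (vals ts s) → WonBy s α (rel R ts) (α *)
    eq-true   : {t u : Term Σ W} → val t s ≡ val u s → WonBy s α (t ≐ u) α
    eq-false  : {t u : Term Σ W} → ¬ val t s ≡ val u s → WonBy s α (t ≐ u) (α *)
    dep-won   : {m n : ℕ} {ts : Vec (Term Σ W) m} {us : Vec (Term Σ W) n} →
                WonBy s α (dep ts us) α

  data Atomic {W : List Var} : Formula Σ W → Set where
    rel : {R : Rel} {ts : Vec (Term Σ W) (relAr R)} → Atomic (rel R ts)
    _≐_ : (t u : Term Σ W) → Atomic (t ≐ u)
    dep : {m n : ℕ} {ts : Vec (Term Σ W) m} {us : Vec (Term Σ W) n} →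
          Atomic (dep ts us)

  module Game {V : List Var} (X : Team V) (ψ : Formula Σ V) where

    -- A nondeterministic strategy for β.  A choosing position of β is given by
    -- an occurrence and an assignment, its player component being β; its
    -- successors correspond bijectively to sides, resp. to elements of Dom.
    -- The -cong fields say that the strategy depends on the assignment only as
    -- a function, which is not automatic without function extensionality.
    record Strategy (β : Player) : Set₁ where
      field
        ∨-choice   : {W : List Var} {χ θ : Formula Σ W} →
                     Occ ψ (χ ∨ θ) → Assignment W → Pred Side 0ℓ
        ex-choice  : {W : List Var} {v : Var} {χ : Formula Σ (v ∷ W)} →
                     Occ ψ (ex v χ) → Assignment W → Pred Dom 0ℓ
        ∨-nonempty : {W : List Var} {χ θ : Formula Σ W}
                     (o : Occ ψ (χ ∨ θ)) (s : Assignment W) →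
                     Satisfiable (∨-choice o s)
        ex-nonempty : {W : List Var} {v : Var} {χ : Formula Σ (v ∷ W)}
                     (o : Occ ψ (ex v χ)) (s : Assignment W) →
                     Satisfiable (ex-choice o s)
        ∨-cong     : {W : List Var} {χ θ : Formula Σ W}
                     (o : Occ ψ (χ ∨ θ)) {s s′ : Assignment W} → s ≈ s′ →
                     {d : Side} → d ∈ₚ ∨-choice o s → d ∈ₚ ∨-choice o s′
        ex-cong    : {W : List Var} {v : Var} {χ : Formula Σ (v ∷ W)}
                     (o : Occ ψ (ex v χ)) {s s′ : Assignment W} → s ≈ s′ →
                     {m : Dom} → m ∈ₚ ex-choice o s → m ∈ₚ ex-choice o s′

    open Strategy

    -- Play σ o s α: the plays conforming to σ, from a starting position up to
    -- the position (o, s, α).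
    data Play {β : Player} (σ : Strategy β) :
              {W : List Var} {χ : Formula Σ W} →
              Occ ψ χ → Assignment W → Player → Set where
      start   : {s : Assignment V} → s ∈ₚ X → Play σ root s Eloise
      ∼-move  : {W : List Var} {χ : Formula Σ W} {o : Occ ψ (∼ χ)}
                {s : Assignment W} {α : Player} →
                Play σ o s α → Play σ (∼↓ o) s (α *)
      ∨-moveˡ : {W : List Var} {χ θ : Formula Σ W} {o : Occ ψ (χ ∨ θ)}
                {s : Assignment W} {α : Player} →
                Play σ o s α → (α ≡ β → left ∈ₚ ∨-choice σ o s) →
                Play σ (∨↓ˡ o) s α
      ∨-moveʳ : {W : List Var} {χ θ : Formula Σ W} {o : Occ ψ (χ ∨ θ)}
                {s : Assignment W} {α : Player} →
                Play σ o s α → (α ≡ β → right ∈ₚ ∨-choice σ o s) →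
                Play σ (∨↓ʳ o) s α
      ex-move : {W : List Var} {v : Var} {χ : Formula Σ (v ∷ W)} {o : Occ ψ (ex v χ)}
                {s : Assignment W} {α : Player} (m : Dom) →
                Play σ o s α → (α ≡ β → m ∈ₚ ex-choice σ o s) →
                Play σ (ex↓ o) (s [ m / v ]) α

    Winning : {β : Player} → Strategy β → Set
    Winning {β} σ =
      {W : List Var} {χ : Formula Σ W} {o : Occ ψ χ} {s : Assignment W} {α : Player} →
      Play σ o s α → Atomic χ → WonBy s α χ β

    Uniform : {β : Player} → Strategy β → Set
    Uniform {β} σ =
      {W : List Var} {m n : ℕ} {ts : Vec (Term Σ W) m} {us : Vec (Term Σ W) n}
      (o : Occ ψ (dep ts us)) {s s′ : Assignment W} →
      Play σ o s β → Play σ o s′ β →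
      vals ts s ≡ vals ts s′ → vals us s ≡ vals us s′

    HasUniformWinningStrategy : Player → Set₁
    HasUniformWinningStrategy β = ∃[ σ ] (Winning {β} σ × Uniform σ)

  satisfies : Sign → {V : List Var} → Team V → Formula Σ V → Set₁
  satisfies pos X ψ = ¬ Game.HasUniformWinningStrategy X ψ Abelard
  satisfies neg X ψ = ¬ Game.HasUniformWinningStrategy X ψ Eloise

_⊨[_]_ : {Σ : Signature} → Model Σ → Sign → Sentence Σ → Set₁
M ⊨[ d ] φ = satisfies M d (｛∅｝ M) φ

Consistent : {Σ : Signature} → Sentence Σ → Set₁
Consistent {Σ} φ = ¬ (∃[ M ] (M ⊨[ pos ] φ × M ⊨[ neg ] φ))

{-# OPTIONS --safe #-}

-- A uniform winning strategy in the game of φ is one in the game of φᶠ, where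
-- uniformity is void: a play that would stop at a dependence atom, won by the
-- player to move, continues to an identity won by that same player.  Conversely,
-- if β wins the game of φᶠ then β* does not, so β* does not win the game of φ
-- uniformly either; consistency leaves only β as the uniform winner of that game.

module Submission where

open import Defs
open import Data.Empty using (⊥; ⊥-elim)
open import Data.List.Base using (List; _∷_)
open import Data.Product.Base using (_,_)
open import Data.Unit.Base using (⊤; tt)
open import Function.Bundles using (_⇔_; mk⇔)
open import Level using (0ℓ)
open import Relation.Binary.PropositionalEquality using (_≡_; refl)
open import Relation.Nullary using (¬_)
open import Relation.Unary using (Pred; Satisfiable) renaming (_∈_ to _∈ₚ_)

*-involutive : (α : Player) → (α *) * ≡ α
*-involutive Eloise  = refl
*-involutive Abelard = refl

-- Origin ψ χ′ says where an occurrence of χ′ in flatten ψ comes from: either an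
-- occurrence in ψ, or the inside of the sentence truth replacing a dependence atom.
data Origin {Σ : Signature} {V : List Var} (ψ : Formula Σ V) :
            {W : List Var} → Formula Σ W → Set where
  flat     : {W : List Var} {χ′ : Formula Σ W} (χ : Formula Σ W) →
             Occ ψ χ → flatten χ ≡ χ′ → Origin ψ χ′
  truth-ex : {W : List Var} {v : Var} {t : Term Σ (v ∷ W)} → Origin ψ (ex v (∼ (t ≐ t)))
  truth-∼  : {W : List Var} {t : Term Σ W} → Origin ψ (∼ (t ≐ t))
  truth-≐  : {W : List Var} {t : Term Σ W} → Origin ψ (t ≐ t)

module _ {Σ : Signature} {V : List Var} {ψ : Formula Σ V} where

  -- Matching on the source formula lets the equation in `flat` reduce to `refl`. Only a negation or
  -- a dependence atom flattens to a negation. The outermost formula of `truth` thus still counts as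
  -- `flat`, and `truth-ex` is entered one move later.
  origin-∼ : {W : List Var} {χ′ : Formula Σ W} → Origin ψ (∼ χ′) → Origin ψ χ′
  origin-∼ (flat (dep _ _) _ refl) = truth-ex
  origin-∼ (flat (∼ χ) o refl)     = flat χ (∼↓ o) refl
  origin-∼ truth-∼                 = truth-≐

  origin-∨ˡ : {W : List Var} {χ′ θ′ : Formula Σ W} → Origin ψ (χ′ ∨ θ′) → Origin ψ χ′
  origin-∨ˡ (flat (χ ∨ _) o refl) = flat χ (∨↓ˡ o) refl

  origin-∨ʳ : {W : List Var} {χ′ θ′ : Formula Σ W} → Origin ψ (χ′ ∨ θ′) → Origin ψ θ′
  origin-∨ʳ (flat (_ ∨ θ) o refl) = flat θ (∨↓ʳ o) refl

  origin-ex : {W : List Var} {v : Var} {χ′ : Formula Σ (v ∷ W)} →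
              Origin ψ (ex v χ′) → Origin ψ χ′
  origin-ex (flat (ex _ χ) o refl) = flat χ (ex↓ o) refl
  origin-ex truth-ex               = truth-∼

  origin : {W : List Var} {χ′ : Formula Σ W} → Occ (flatten ψ) χ′ → Origin ψ χ′
  origin root    = flat ψ root refl
  origin (∼↓ o)  = origin-∼ (origin o)
  origin (∨↓ˡ o) = origin-∨ˡ (origin o)
  origin (∨↓ʳ o) = origin-∨ʳ (origin o)
  origin (ex↓ o) = origin-ex (origin o)

  -- No clause of `flatten` yields a dependence atom, and none occurs inside `truth`. This makes
  -- every strategy in the flattened game uniform.
  no-dep-origin : {W : List Var} {m n : _} {ts : _} {us : _} →
                  Origin ψ {W} (dep {m = m} {n} ts us) → ⊥
  no-dep-origin (flat (rel _ _) _ ())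
  no-dep-origin (flat (_ ≐ _) _ ())
  no-dep-origin (flat (dep _ _) _ ())
  no-dep-origin (flat (∼ _) _ ())
  no-dep-origin (flat (_ ∨ _) _ ())
  no-dep-origin (flat (ex _ _) _ ())

module _ {Σ : Signature} (M : Model Σ) {V : List Var} (X : Team M V) (ψ : Formula Σ V) where
  open Model M
  open Game M

  module FlattenStrategy {β : Player} (σ : Strategy X ψ β) where
    open Strategy X ψ σ

    ∨-choiceᶠ : {W : List Var} {χ θ : Formula Σ W} →
                Origin ψ (χ ∨ θ) → Assignment M W → Pred Side 0ℓ
    ∨-choiceᶠ (flat (_ ∨ _) o refl) s = ∨-choice o s

    ex-choiceᶠ : {W : List Var} {v : Var} {χ : Formula Σ (v ∷ W)} →
                 Origin ψ (ex v χ) → Assignment M W → Pred Dom 0ℓ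
    ex-choiceᶠ (flat (ex _ _) o refl) s = ex-choice o s
    -- An arbitrary value: when `σ` is winning, `Reached` shows that the opponent of `β` moves here.
    ex-choiceᶠ truth-ex               s = λ _ → ⊤

    ∨-nonemptyᶠ : {W : List Var} {χ θ : Formula Σ W}
                  (p : Origin ψ (χ ∨ θ)) (s : Assignment M W) →
                  Satisfiable (∨-choiceᶠ p s)
    ∨-nonemptyᶠ (flat (_ ∨ _) o refl) s = ∨-nonempty o s

    ex-nonemptyᶠ : {W : List Var} {v : Var} {χ : Formula Σ (v ∷ W)}
                   (p : Origin ψ (ex v χ)) (s : Assignment M W) →
                   Satisfiable (ex-choiceᶠ p s)
    ex-nonemptyᶠ (flat (ex _ _) o refl) s = ex-nonempty o s
    ex-nonemptyᶠ truth-ex               s = nonempty , tt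

    ∨-congᶠ : {W : List Var} {χ θ : Formula Σ W}
              (p : Origin ψ (χ ∨ θ)) {s s′ : Assignment M W} → _≈_ M s s′ →
              {d : Side} → d ∈ₚ ∨-choiceᶠ p s → d ∈ₚ ∨-choiceᶠ p s′
    ∨-congᶠ (flat (_ ∨ _) o refl) = ∨-cong o

    ex-congᶠ : {W : List Var} {v : Var} {χ : Formula Σ (v ∷ W)}
               (p : Origin ψ (ex v χ)) {s s′ : Assignment M W} → _≈_ M s s′ →
               {m : Dom} → m ∈ₚ ex-choiceᶠ p s → m ∈ₚ ex-choiceᶠ p s′
    ex-congᶠ (flat (ex _ _) o refl) = ex-cong o
    ex-congᶠ truth-ex               = λ _ _ → tt

    flattenStrategy : Strategy X (flatten ψ) β
    flattenStrategy = record
      { ∨-choice    = λ o → ∨-choiceᶠ (origin o)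
      ; ex-choice   = λ o → ex-choiceᶠ (origin o)
      ; ∨-nonempty  = λ o → ∨-nonemptyᶠ (origin o)
      ; ex-nonempty = λ o → ex-nonemptyᶠ (origin o)
      ; ∨-cong      = λ o → ∨-congᶠ (origin o)
      ; ex-cong     = λ o → ex-congᶠ (origin o)
      }

    -- What is known about a position (χ, s, α) of the flattened game once it is
    -- reached: inside a truth, α is determined, as β wins the dependence atom.
    Reached : {W : List Var} {χ : Formula Σ W} →
              Origin ψ χ → Assignment M W → Player → Set
    Reached (flat _ o _) s α = Play X ψ σ o s α
    Reached truth-ex     s α = α ≡ β *
    Reached truth-∼      s α = α ≡ β *
    Reached truth-≐      s α = α ≡ β

    module _ (win : Winning X ψ σ) where

      reached-∼ : {W : List Var} {χ : Formula Σ W} {s : Assignment M W} {α : Player}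
                  (p : Origin ψ (∼ χ)) → Reached p s α → Reached (origin-∼ p) s (α *)
      -- The play `π` of `σ` ends at the dependence atom. Its only possible winner is the player to
      -- move, so `α` is `β`, and the outer negation of `truth` hands the turn to `β *`.
      reached-∼ (flat (dep _ _) _ refl) π with win π dep
      ... | dep-won = refl
      reached-∼ (flat (∼ _) _ refl) π    = ∼-move π
      reached-∼ truth-∼             refl = *-involutive β

      reached-∨ˡ : {W : List Var} {χ θ : Formula Σ W} {s : Assignment M W} {α : Player}
                   (p : Origin ψ (χ ∨ θ)) → Reached p s α →
                   (α ≡ β → left ∈ₚ ∨-choiceᶠ p s) → Reached (origin-∨ˡ p) s α
      reached-∨ˡ (flat (_ ∨ _) _ refl) = ∨-moveˡ

      reached-∨ʳ : {W : List Var} {χ θ : Formula Σ W} {s : Assignment M W} {α : Player}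
                   (p : Origin ψ (χ ∨ θ)) → Reached p s α →
                   (α ≡ β → right ∈ₚ ∨-choiceᶠ p s) → Reached (origin-∨ʳ p) s α
      reached-∨ʳ (flat (_ ∨ _) _ refl) = ∨-moveʳ

      reached-ex : {W : List Var} {v : Var} {χ : Formula Σ (v ∷ W)}
                   {s : Assignment M W} {α : Player}
                   (p : Origin ψ (ex v χ)) (m : Dom) → Reached p s α →
                   (α ≡ β → m ∈ₚ ex-choiceᶠ p s) →
                   Reached (origin-ex p) (_[_/_] M s m v) α
      reached-ex (flat (ex _ _) _ refl) m π c = ex-move m π c
      reached-ex truth-ex               m e _ = e

      reached : {W : List Var} {χ : Formula Σ W} {o : Occ (flatten ψ) χ}
                {s : Assignment M W} {α : Player} →
                Play X (flatten ψ) flattenStrategy o s α → Reached (origin o) s α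
      reached (start s∈X)                 = start s∈X
      reached (∼-move {o = o} π)          = reached-∼ (origin o) (reached π)
      reached (∨-moveˡ {o = o} π c)       = reached-∨ˡ (origin o) (reached π) c
      reached (∨-moveʳ {o = o} π c)       = reached-∨ʳ (origin o) (reached π) c
      reached (ex-move {o = o} m π c)     = reached-ex (origin o) m (reached π) c

      -- First-order atoms are their own flattenings, so `win` applies to them directly. The
      -- identity inside `truth` always holds and is won by the player to move, which is `β` after
      -- the two negations.
      reached-atom : {W : List Var} {χ : Formula Σ W} {s : Assignment M W} {α : Player}
                     (p : Origin ψ χ) → Reached p s α → Atomic M χ → WonBy M s α χ β
      reached-atom (flat (rel _ _) _ refl) π    rel     = win π rel
      reached-atom (flat (t ≐ u) _ refl)   π    (_ ≐ _) = win π (t ≐ u)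
      reached-atom truth-≐                 refl (_ ≐ _) = eq-true refl

      flatten-winning : Winning X (flatten ψ) flattenStrategy
      flatten-winning {o = o} π = reached-atom (origin o) (reached π)

  flatten-wins : {β : Player} → HasUniformWinningStrategy X ψ β →
                 HasUniformWinningStrategy X (flatten ψ) β
  flatten-wins (σ , win , _) =
    flattenStrategy , flatten-winning win , λ o _ _ → ⊥-elim (no-dep-origin (origin o))
    where open FlattenStrategy σ

module _ {Σ : Signature} (M : Model Σ) where
  open Game M

  -- Splitting on `α` makes `α *` compute, so that two different winners force the same atom to be
  -- both true and false.
  unique-winner : {W : List Var} {χ : Formula Σ W} {s : Assignment M W} (α : Player) →
                  WonBy M s α χ Eloise → ¬ WonBy M s α χ Abelard
  unique-winner Eloise  (rel-true p)  (rel-false q) = q p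
  unique-winner Eloise  (eq-true p)   (eq-false q)  = q p
  unique-winner Abelard (rel-false q) (rel-true p)  = q p
  unique-winner Abelard (eq-false q)  (eq-true p)   = q p

  module _ {V : List Var} {X : Team M V} {ψ : Formula Σ V}
           {σ : Strategy X ψ Eloise} {τ : Strategy X ψ Abelard}
           (winσ : Winning X ψ σ) (winτ : Winning X ψ τ) where
    open Strategy X ψ

    -- A play conforming to both strategies can always be prolonged: the player to move follows a
    -- choice of their own strategy, and the other strategy puts no constraint on that move, whence
    -- `λ ()`. At an atom both players would have won.
    no-common-play : {W : List Var} (χ : Formula Σ W) {o : Occ ψ χ}
                     {s : Assignment M W} (α : Player) →
                     Play X ψ σ o s α → ¬ Play X ψ τ o s α
    no-common-play (rel R ts)  α π ρ = unique-winner α (winσ π rel) (winτ ρ rel)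
    no-common-play (t ≐ u)     α π ρ = unique-winner α (winσ π (t ≐ u)) (winτ ρ (t ≐ u))
    no-common-play (dep ts us) α π ρ = unique-winner α (winσ π dep) (winτ ρ dep)
    no-common-play (∼ χ)       α π ρ = no-common-play χ (α *) (∼-move π) (∼-move ρ)
    no-common-play (χ ∨ θ) {o} {s} Eloise π ρ with ∨-nonempty σ o s
    ... | left  , c = no-common-play χ Eloise (∨-moveˡ π λ _ → c) (∨-moveˡ ρ λ ())
    ... | right , c = no-common-play θ Eloise (∨-moveʳ π λ _ → c) (∨-moveʳ ρ λ ())
    no-common-play (χ ∨ θ) {o} {s} Abelard π ρ with ∨-nonempty τ o s
    ... | left  , c = no-common-play χ Abelard (∨-moveˡ π λ ()) (∨-moveˡ ρ λ _ → c)
    ... | right , c = no-common-play θ Abelard (∨-moveʳ π λ ()) (∨-moveʳ ρ λ _ → c)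
    no-common-play (ex v χ) {o} {s} Eloise π ρ with ex-nonempty σ o s
    ... | m , c = no-common-play χ Eloise (ex-move m π λ _ → c) (ex-move m ρ λ ())
    no-common-play (ex v χ) {o} {s} Abelard π ρ with ex-nonempty τ o s
    ... | m , c = no-common-play χ Abelard (ex-move m π λ ()) (ex-move m ρ λ _ → c)

  -- A member of `X` starts the common play; over an empty team both players win vacuously.
  not-both-win : {V : List Var} {X : Team M V} {ψ : Formula Σ V} → Satisfiable X →
                 HasUniformWinningStrategy X ψ Eloise →
                 ¬ HasUniformWinningStrategy X ψ Abelard
  not-both-win {ψ = ψ} (s , s∈X) (σ , winσ , _) (τ , winτ , _) =
    no-common-play {σ = σ} {τ} winσ winτ ψ Eloise (start s∈X) (start s∈X)

theorem3p19 : (Σ : Signature) (φ : Sentence Σ) → Consistent φ →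
    (M : Model Σ) (d : Sign) → (M ⊨[ d ] φ) ⇔ (M ⊨[ d ] flatten φ)
theorem3p19 Σ φ consistent M = equivalence
  where
  flattens : {β : Player} → Game.HasUniformWinningStrategy M (｛∅｝ M) φ β →
             Game.HasUniformWinningStrategy M (｛∅｝ M) (flatten φ) β
  flattens = flatten-wins M (｛∅｝ M) φ

  ∅∈ : Satisfiable (｛∅｝ M)
  ∅∈ = ∅ M , λ _ _ → refl

  equivalence : (d : Sign) → (M ⊨[ d ] φ) ⇔ (M ⊨[ d ] flatten φ)
  equivalence pos = mk⇔
    -- If Abelard wins the flattened game by `a`, Eloise cannot win the game of `φ` by any `e`, so
    -- `M` satisfies `φ` with both signs. The converse is the contrapositive of `flattens`.
    (λ φ⁺ a → consistent (M , φ⁺ , λ e → not-both-win M ∅∈ (flattens e) a))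
    (λ φᶠ⁺ a → φᶠ⁺ (flattens a))
  equivalence neg = mk⇔
    (λ φ⁻ e → consistent (M , (λ a → not-both-win M ∅∈ e (flattens a)) , φ⁻))
    (λ φᶠ⁻ e → φᶠ⁻ (flattens e))
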